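{- Let $q$ be a prime power with $q=4m+1\ge 13$, where $m\ge 2$ is an integer. Let $\theta$ be a primitive element of $\mathbb{F}_q$, put $\beta=\theta^2$, $C=\langle\beta^m\rangle=\langle\theta^{2m}\rangle\le\mathbb{F}_q^*$, and $A_j=\beta^jC$ for $0\le j\le m-1$. Then there exists $c\in\{1,\dots,m-1\}$ such that the family $\{A_0,\dots,A_{m-1}\}$ is a $(q,m,2;1)$-$c$-CEDF in $(\mathbb{F}_q,+)$.
   Context: Let $(G,+)$ be a finite abelian group of order $n$ (written additively), let $l,m\ge 2$, and let $c\in\{1,\dots,m-1\}$. For non-empty subsets $A,B\subseteq G$, $\Delta(A,B)$ denotes the multiset $\{\{a-b: a\in A, b\in B\}\}$. A family $\{A_0,\dots,A_{m-1}\}$ of $m$ pairwise disjoint subsets of $G$ is an $(n,m,l;\lambda)$-$c$-circular external difference family (CEDF) in $G$ if $|A_i|=l$ for all $i$ and each nonzero $g\in G$ occurs exactly $\lambda$ times in the multiset union $\bigcup_{i=0}^{m-1}\Delta(A_{i+c},A_i)$, where subscripts are taken modulo $m$. -}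

module Defs where

open import Level using (0ℓ)
open import Data.Nat using (ℕ; zero; suc; _≤_; _<_; NonZero)
import Data.Nat as ℕ
open import Data.Nat.DivMod using (_mod_)
open import Data.Fin using (Fin; toℕ)
import Data.Fin as Fin
open import Data.Bool using (Bool; true; false; _∧_; if_then_else_)
open import Data.List using (List; []; _∷_; map; allFin; upTo; concatMap)
open import Data.Nat.ListAction using (sum)
open import Data.Bool.ListAction using (any)
open import Data.Product using (_×_; ∃; Σ; _,_; proj₁; proj₂)
open import Data.Nat.Primality using (Prime)
open import Relation.Nullary using (¬_; Dec; yes; no; does)
open import Relation.Binary.PropositionalEquality using (_≡_; refl; sym; trans; cong)
open import Function.Bundles using (_↔_; Inverse)
open import Algebra.Core using (Op₁; Op₂)
open import Algebra.Structures using (IsAbelianGroup; IsCommutativeRing)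

-- A finite abelian group of order n, written additively, with
-- propositional equality and an explicit enumeration Fin n ↔ G.
record FinAbGroup (n : ℕ) : Set₁ where
  field
    Carrier : Set
    _+_ : Op₂ Carrier
    -_ : Op₁ Carrier
    0# : Carrier
    isAbelianGroup : IsAbelianGroup _≡_ _+_ 0# -_
    enum : Fin n ↔ Carrier

  _-_ : Op₂ Carrier
  a - b = a + (- b)

  -- decidable equality, derived from the enumeration
  _≟_ : (x y : Carrier) → Dec (x ≡ y)
  x ≟ y with Inverse.from enum x Fin.≟ Inverse.from enum y
  ... | yes e = yes (trans (sym (Inverse.inverseˡ enum refl))
                     (trans (cong (Inverse.to enum) e) (Inverse.inverseˡ enum refl)))
  ... | no ne = no (λ e → ne (cong (Inverse.from enum) e))

  -- the list of all elements of G (each exactly once)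
  elements : List Carrier
  elements = map (Inverse.to enum) (allFin n)

-- Subsets of a finite set, as characteristic functions.
Subset : Set → Set
Subset X = X → Bool

countB : {X : Set} → (X → Bool) → List X → ℕ
countB p [] = 0
countB p (x ∷ xs) = if p x then suc (countB p xs) else countB p xs

module _ {n : ℕ} (G : FinAbGroup n) where
  open FinAbGroup G

  -- |A|
  card : Subset Carrier → ℕ
  card A = countB A elements

  -- multiplicity of g in the multiset Δ(A,B) = {{ a - b : a ∈ A, b ∈ B }}
  multΔ : Subset Carrier → Subset Carrier → Carrier → ℕ
  multΔ A B g =
    countB (λ ab → A (proj₁ ab) ∧ B (proj₂ ab)
                   ∧ does ((proj₁ ab - proj₂ ab) ≟ g))
           (concatMap (λ a → map (λ b → (a , b)) elements) elements)

-- i + c taken modulo m, for i : Fin m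
shift : {m : ℕ} → Fin m → ℕ → Fin m
shift {suc k} i c = (toℕ i ℕ.+ c) mod (suc k)

-- (n,m,l;λ)-c-CEDF in G (G of order n), family A₀,…,A_{m-1} given as A : Fin m → Subset G
IsCEDF : {n : ℕ} (G : FinAbGroup n) (m l λ' c : ℕ) → (Fin m → Subset (FinAbGroup.Carrier G)) → Set
IsCEDF {n} G m l λ' c A =
  2 ≤ l × 2 ≤ m × 1 ≤ c × c < m
  × (∀ (i j : Fin m) → ¬ i ≡ j → ∀ x → ¬ (A i x ≡ true × A j x ≡ true))
  × (∀ (i : Fin m) → card G (A i) ≡ l)
  × (∀ (g : Carrier) → ¬ g ≡ 0# →
       sum (map (λ i → multΔ G (A (shift i c)) (A i) g) (allFin m)) ≡ λ')
  where open FinAbGroup G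

-- A finite field with q elements (propositional equality, explicit enumeration).
record FiniteField (q : ℕ) : Set₁ where
  field
    Carrier : Set
    _+_ _*_ : Op₂ Carrier
    -_ : Op₁ Carrier
    0# 1# : Carrier
    isCommutativeRing : IsCommutativeRing _≡_ _+_ _*_ -_ 0# 1#
    0≢1 : ¬ 0# ≡ 1#
    inverse : ∀ x → ¬ x ≡ 0# → ∃ λ y → x * y ≡ 1#
    enum : Fin q ↔ Carrier

  -- natural-number powers
  _^_ : Carrier → ℕ → Carrier
  x ^ zero = 1#
  x ^ suc k = x * (x ^ k)

  -- θ is a primitive element: it generates the multiplicative group F*
  IsPrimitive : Carrier → Set
  IsPrimitive θ = ¬ θ ≡ 0# × (∀ x → ¬ x ≡ 0# → ∃ λ k → θ ^ k ≡ x)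

  -- the additive group (F, +)
  additiveGroup : FinAbGroup q
  additiveGroup = record
    { Carrier = Carrier ; _+_ = _+_ ; -_ = -_ ; 0# = 0#
    ; isAbelianGroup = IsCommutativeRing.+-isAbelianGroup isCommutativeRing
    ; enum = enum }

  open FinAbGroup additiveGroup public using (_≟_; elements)

  -- the cyclic subgroup ⟨g⟩ = {g^k : k ∈ ℕ} of F*; since F* is finite of order q - 1,
  -- the exponents k < q already give every power of g.
  ⟨_⟩ : Carrier → Subset Carrier
  ⟨ g ⟩ x = any (λ k → does ((g ^ k) ≟ x)) (upTo q)

  -- the coset h·S = {h * s : s ∈ S}
  _·_ : Carrier → Subset Carrier → Subset Carrier
  (h · S) x = any (λ s → S s ∧ does ((h * s) ≟ x)) elements

IsPrimePower : ℕ → Set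
IsPrimePower q = ∃ λ p → ∃ λ k → Prime p × q ≡ p ℕ.^ suc k

{-# OPTIONS --safe #-}
module Submission where

-- The primitive element θ has order 4m, so -1 = θ^(2m), the family is A_j = {±θ^(2j)}, and the
-- elements ±θ^(2j) (j < m) are the nonzero squares, each listed once. With x = θ^(2c), the
-- differences a - b with a ∈ A_(j+c), b ∈ A_j are ±θ^(2j)(x - 1) and ±θ^(2j)(x + 1), so they
-- cover every nonzero element exactly once as soon as x - 1 and x + 1 lie in different square
-- classes, i.e. as soon as x² - 1 = θ^(4c) - 1 is a nonsquare. Such a c ∈ [1, m) exists:
-- otherwise 0 and the m fourth powers θ^(4j) would have pairwise square differences, and since
-- θ is a nonsquare the (m + 1)² elements a + θ b built from them would be distinct, which is
-- impossible among 4m + 1 elements once m ≥ 3.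

open import Level using (0ℓ)
open import Data.Nat as ℕ using (ℕ; zero; suc; _≤_; _<_; _∸_; z≤n; s≤s; NonZero; >-nonZero)
import Data.Nat.Properties as ℕ
open import Data.Nat.Base using (parity)
open import Data.Nat.DivMod using (_%_; _/_; _mod_; m≡m%n+[m/n]*n; m%n<n)
open import Data.Nat.ListAction using (sum)
open import Data.Nat.Tactic.RingSolver using (solve-∀)
open import Data.Parity.Base using (Parity; 0ℙ; 1ℙ)
open import Data.Bool using (Bool; true; false; T; _∧_; if_then_else_)
open import Data.Bool.Properties using (T-≡; T-∧; ¬-not)
open import Data.Fin as Fin using (Fin; toℕ; fromℕ<; punchOut)
open import Data.Fin.Properties
  using (*↔×; toℕ<n; toℕ-fromℕ<; toℕ-injective; pigeonhole; injective⇒≤; punchOut-injective; any?)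
open import Data.List using (List; []; _∷_; _++_; map; concatMap; allFin; upTo; cartesianProduct)
open import Data.List.Relation.Unary.All as All using (All)
open import Data.List.Relation.Unary.Any using (here; there; satisfied)
open import Data.List.Relation.Unary.Any.Properties using (any⁺; any⁻)
open import Data.List.Relation.Unary.AllPairs using (_∷_)
open import Data.List.Relation.Unary.Unique.Propositional using (Unique)
open import Data.List.Relation.Unary.Unique.Propositional.Properties using (map⁺; allFin⁺; cartesianProduct⁺)
open import Data.List.Membership.Propositional using (_∈_; lose)
open import Data.List.Membership.Propositional.Properties
  using (∈-map⁺; ∈-allFin; ∈-upTo⁺; ∈-cartesianProduct⁺)
open import Data.Product using (Σ; ∃-syntax; _×_; _,_; proj₁; proj₂)
open import Data.Sign as Sign using (Sign)
open import Data.Sign.Properties as Sign using (s*s≡+; s≢opposite[s])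
open import Data.Sum using (_⊎_; inj₁; inj₂; [_,_]; [_,_]′)
open import Function using (_∘_; _$_; id)
open import Function.Bundles using (Inverse; Injection; Equivalence)
open import Function.Properties.Inverse using (↔⇒↣; ↔-sym)
open import Relation.Binary.Definitions using (tri<; tri≈; tri>)
open import Relation.Binary.PropositionalEquality hiding ([_])
open import Relation.Binary.PropositionalEquality.Properties using (subst-injective)
open import Relation.Nullary using (¬_; Dec; yes; no; does; contradiction)
open import Relation.Nullary.Decidable using (dec-true; _×-dec_)
open import Algebra.Bundles using (CommutativeRing)
open import Defs

module ℙ where
  open import Data.Parity.Base public
  open import Data.Parity.Properties public

open ≡-Reasoning

module _ {X : Set} (f : X → ℕ) where

  sum-map-vanishing : ∀ {xs} → (∀ {x} → x ∈ xs → f x ≡ 0) → sum (map f xs) ≡ 0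
  sum-map-vanishing {[]}     _      = refl
  sum-map-vanishing {x ∷ xs} vanish = cong₂ ℕ._+_ (vanish (here refl)) (sum-map-vanishing (vanish ∘ there))

  sum-map-single : ∀ {xs a} → Unique xs → a ∈ xs → (∀ {x} → x ∈ xs → x ≢ a → f x ≡ 0) →
                   sum (map f xs) ≡ f a
  sum-map-single {a ∷ xs} (a∉xs ∷ _) (here refl) vanish = begin
    f a ℕ.+ sum (map f xs)  ≡⟨ cong (f a ℕ.+_) (sum-map-vanishing (λ x∈ →
                                  vanish (there x∈) (≢-sym (All.lookup a∉xs x∈)))) ⟩
    f a ℕ.+ 0               ≡⟨ ℕ.+-identityʳ (f a) ⟩
    f a                     ∎
  sum-map-single (y∉xs ∷ u) (there a∈) vanish =
    cong₂ ℕ._+_ (vanish (here refl) (All.lookup y∉xs a∈)) (sum-map-single u a∈ (vanish ∘ there))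

  sum-map-pair : ∀ {xs a b} → Unique xs → a ∈ xs → b ∈ xs → a ≢ b →
                 (∀ {x} → x ∈ xs → x ≢ a → x ≢ b → f x ≡ 0) → sum (map f xs) ≡ f a ℕ.+ f b
  sum-map-pair _ (here refl) (here refl) a≢b _ = contradiction refl a≢b
  sum-map-pair {a ∷ xs} (a∉xs ∷ u) (here refl) (there b∈) _ vanish =
    cong (f a ℕ.+_) (sum-map-single u b∈ (λ x∈ → vanish (there x∈) (≢-sym (All.lookup a∉xs x∈))))
  sum-map-pair {b ∷ xs} {a} (b∉xs ∷ u) (there a∈) (here refl) _ vanish = begin
    f b ℕ.+ sum (map f xs)  ≡⟨ cong (f b ℕ.+_) (sum-map-single u a∈ (λ x∈ x≢a →
                                  vanish (there x∈) x≢a (≢-sym (All.lookup b∉xs x∈)))) ⟩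
    f b ℕ.+ f a             ≡⟨ ℕ.+-comm (f b) (f a) ⟩
    f a ℕ.+ f b             ∎
  sum-map-pair (y∉xs ∷ u) (there a∈) (there b∈) a≢b vanish =
    cong₂ ℕ._+_ (vanish (here refl) (All.lookup y∉xs a∈) (All.lookup y∉xs b∈))
                (sum-map-pair u a∈ b∈ a≢b (vanish ∘ there))

module _ {X : Set} (p : X → Bool) where

  indicator : X → ℕ
  indicator x = if p x then 1 else 0

  countB≡sum-indicator : ∀ xs → countB p xs ≡ sum (map indicator xs)
  countB≡sum-indicator []       = refl
  countB≡sum-indicator (x ∷ xs) with p x
  ... | true  = cong suc (countB≡sum-indicator xs)
  ... | false = countB≡sum-indicator xs

  indicator-true : ∀ {x} → p x ≡ true → indicator x ≡ 1
  indicator-true px = cong (λ b → if b then 1 else 0) px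

  indicator-vanishes : ∀ {x} → ¬ p x ≡ true → indicator x ≡ 0
  indicator-vanishes ¬px = cong (λ b → if b then 1 else 0) (¬-not ¬px)

  countB-none : ∀ xs → (∀ {x} → x ∈ xs → ¬ p x ≡ true) → countB p xs ≡ 0
  countB-none xs none = trans (countB≡sum-indicator xs) (sum-map-vanishing indicator (indicator-vanishes ∘ none))

  countB-single : ∀ {xs a} → Unique xs → a ∈ xs → p a ≡ true →
                  (∀ {x} → x ∈ xs → p x ≡ true → x ≡ a) → countB p xs ≡ 1
  countB-single {xs} u a∈ pa only = begin
    countB p xs             ≡⟨ countB≡sum-indicator xs ⟩
    sum (map indicator xs)  ≡⟨ sum-map-single indicator u a∈ (λ x∈ x≢a → indicator-vanishes (x≢a ∘ only x∈)) ⟩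
    indicator _             ≡⟨ indicator-true pa ⟩
    1                       ∎

  countB-pair : ∀ {xs a b} → Unique xs → a ∈ xs → b ∈ xs → a ≢ b → p a ≡ true → p b ≡ true →
                (∀ {x} → x ∈ xs → p x ≡ true → x ≡ a ⊎ x ≡ b) → countB p xs ≡ 2
  countB-pair {xs} u a∈ b∈ a≢b pa pb only = begin
    countB p xs                  ≡⟨ countB≡sum-indicator xs ⟩
    sum (map indicator xs)       ≡⟨ sum-map-pair indicator u a∈ b∈ a≢b
                                      (λ x∈ x≢a x≢b → indicator-vanishes ([ x≢a , x≢b ] ∘ only x∈)) ⟩
    indicator _ ℕ.+ indicator _  ≡⟨ cong₂ ℕ._+_ (indicator-true pa) (indicator-true pb) ⟩
    2                            ∎

concatMap-pairs≡cartesianProduct : ∀ {A B : Set} (xs : List A) (ys : List B) →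
                                   concatMap (λ a → map (λ b → (a , b)) ys) xs ≡ cartesianProduct xs ys
concatMap-pairs≡cartesianProduct []       ys = refl
concatMap-pairs≡cartesianProduct (x ∷ xs) ys =
  cong (map (x ,_) ys ++_) (concatMap-pairs≡cartesianProduct xs ys)

module _ {n : ℕ} (G : FinAbGroup n) where

  open FinAbGroup G

  elements-unique : Unique elements
  elements-unique = map⁺ (Injection.injective (↔⇒↣ enum)) (allFin⁺ n)

  ∈-elements : ∀ x → x ∈ elements
  ∈-elements x = subst (_∈ elements) (Inverse.strictlyInverseˡ enum x) (∈-map⁺ (Inverse.to enum) (∈-allFin _))

  card≡2 : ∀ {A : Subset Carrier} {a b} → A a ≡ true → A b ≡ true → a ≢ b →
           (∀ x → A x ≡ true → x ≡ a ⊎ x ≡ b) → card G A ≡ 2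
  card≡2 {A} A∋a A∋b a≢b only =
    countB-pair A elements-unique (∈-elements _) (∈-elements _) a≢b A∋a A∋b (λ _ → only _)

  Solves : Subset Carrier → Subset Carrier → Carrier → Carrier × Carrier → Set
  Solves A B g (a , b) = A a ≡ true × B b ≡ true × a - b ≡ g

  solves? : Subset Carrier → Subset Carrier → Carrier → Carrier × Carrier → Bool
  solves? A B g ab = A (proj₁ ab) ∧ B (proj₂ ab) ∧ does ((proj₁ ab - proj₂ ab) ≟ g)

  solves?⁺ : ∀ {A B g} ab → Solves A B g ab → solves? A B g ab ≡ true
  solves?⁺ (a , b) (A∋a , B∋b , a-b≡g) rewrite A∋a | B∋b = dec-true ((a - b) ≟ _) a-b≡g

  solves?⁻ : ∀ {A B g} ab → solves? A B g ab ≡ true → Solves A B g ab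
  solves?⁻ {A} {B} {g} (a , b) e with A a | B b | (a - b) ≟ g
  solves?⁻ (a , b) refl | true | true | yes a-b≡g = refl , refl , a-b≡g

  multΔ≡countB : ∀ A B g → multΔ G A B g ≡ countB (solves? A B g) (cartesianProduct elements elements)
  multΔ≡countB A B g = cong (countB (solves? A B g)) (concatMap-pairs≡cartesianProduct elements elements)

  multΔ-unique : ∀ {A B g} s₀ → Solves A B g s₀ → (∀ s → Solves A B g s → s ≡ s₀) → multΔ G A B g ≡ 1
  multΔ-unique {A} {B} {g} (a , b) sol only = trans (multΔ≡countB A B g)
    (countB-single (solves? A B g) (cartesianProduct⁺ elements-unique elements-unique)
      (∈-cartesianProduct⁺ (∈-elements a) (∈-elements b)) (solves?⁺ {A} {B} {g} (a , b) sol)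
      (λ {s} _ e → only s (solves?⁻ {A} {B} {g} s e)))

  multΔ-none : ∀ {A B g} → (∀ s → ¬ Solves A B g s) → multΔ G A B g ≡ 0
  multΔ-none {A} {B} {g} none = trans (multΔ≡countB A B g)
    (countB-none (solves? A B g) (cartesianProduct elements elements) (λ {s} _ e → none s (solves?⁻ {A} {B} {g} s e)))

-- Relation.Nullary.Decidable.toWitness is phrased with isYes, which does not reduce on the
-- stuck decisions p? met below.
T-does⇒ : ∀ {P : Set} (p? : Dec P) → T (does p?) → P
T-does⇒ (yes p) _ = p

parity-split : ∀ {π₊ π₋} → π₊ ℙ.+ π₋ ≡ 1ℙ → ∀ π → π ≡ π₊ ⊎ π ≡ π₋
parity-split {0ℙ} {1ℙ} _ 0ℙ = inj₁ refl
parity-split {0ℙ} {1ℙ} _ 1ℙ = inj₂ refl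
parity-split {1ℙ} {0ℙ} _ 0ℙ = inj₂ refl
parity-split {1ℙ} {0ℙ} _ 1ℙ = inj₁ refl

parity≡0ℙ⇒≡2* : ∀ k → parity k ≡ 0ℙ → ∃[ j ] k ≡ 2 ℕ.* j
parity≡0ℙ⇒≡2* zero          _    = 0 , refl
parity≡0ℙ⇒≡2* (suc (suc k)) even with parity≡0ℙ⇒≡2* k even
... | j , refl = suc j , sym (ℕ.*-suc 2 j)

2*n+2*n≡4*n : ∀ n → 2 ℕ.* n ℕ.+ 2 ℕ.* n ≡ 4 ℕ.* n
2*n+2*n≡4*n = solve-∀

s*[s*t]≡t : ∀ s t → s Sign.* (s Sign.* t) ≡ t
s*[s*t]≡t s t = trans (sym (Sign.*-assoc s s t)) (cong (Sign._* t) (s*s≡+ s))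

toℕ-shift : ∀ {m} .{{_ : NonZero m}} (i : Fin m) c → toℕ (shift i c) ≡ (toℕ i ℕ.+ c) % m
toℕ-shift {suc _} i c = toℕ-fromℕ< _

module FieldProperties {q : ℕ} (F : FiniteField q) where

  open FiniteField F public using (Carrier; _^_; _·_; ⟨_⟩; _≟_; elements; additiveGroup; inverse)
  open FiniteField F using (0≢1)

  commutativeRing : CommutativeRing 0ℓ 0ℓ
  commutativeRing = record { isCommutativeRing = FiniteField.isCommutativeRing F }

  open CommutativeRing commutativeRing public
    using ( _+_; _*_; -_; _-_; 0#; 1#; +-assoc; +-identityˡ; +-identityʳ; -‿inverseˡ; -‿inverseʳ
          ; *-assoc; *-comm; *-identityˡ; *-identityʳ; distribˡ; zeroˡ; zeroʳ; ring; +-group; +-abelianGroup)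
  open import Algebra.Properties.Ring ring public using (-1*x≈-x; x[y-z]≈xy-xz; [y-z]x≈yx-zx)
  open import Algebra.Properties.Group +-group public
    using (x∙y⁻¹≈ε⇒x≈y; inverseˡ-unique; ⁻¹-involutive; //-rightDividesʳ; ε⁻¹≈ε)
  open import Algebra.Properties.AbelianGroup +-abelianGroup public using (xyx⁻¹≈y; ⁻¹-anti-homo‿-)

  1≢0 : 1# ≢ 0#
  1≢0 = ≢-sym 0≢1

  *-cancelˡ : ∀ {x y z} → x ≢ 0# → x * y ≡ x * z → y ≡ z
  *-cancelˡ {x} {y} {z} x≢0 xy≡xz with inverse x x≢0
  ... | x⁻¹ , xx⁻¹≡1 = begin
    y              ≡⟨ sym (*-identityˡ y) ⟩
    1# * y         ≡⟨ cong (_* y) (trans (sym xx⁻¹≡1) (*-comm x x⁻¹)) ⟩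
    x⁻¹ * x * y    ≡⟨ *-assoc x⁻¹ x y ⟩
    x⁻¹ * (x * y)  ≡⟨ cong (x⁻¹ *_) xy≡xz ⟩
    x⁻¹ * (x * z)  ≡⟨ sym (*-assoc x⁻¹ x z) ⟩
    x⁻¹ * x * z    ≡⟨ cong (_* z) (trans (*-comm x⁻¹ x) xx⁻¹≡1) ⟩
    1# * z         ≡⟨ *-identityˡ z ⟩
    z              ∎

  *-cancelʳ : ∀ {x y z} → x ≢ 0# → y * x ≡ z * x → y ≡ z
  *-cancelʳ {x} {y} {z} x≢0 yx≡zx = *-cancelˡ x≢0 (trans (*-comm x y) (trans yx≡zx (*-comm z x)))

  *-nonzero : ∀ {x y} → x ≢ 0# → y ≢ 0# → x * y ≢ 0#
  *-nonzero {x} x≢0 y≢0 xy≡0 = y≢0 (*-cancelˡ x≢0 (trans xy≡0 (sym (zeroʳ x))))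

  *≡0⇒ : ∀ {x y} → x * y ≡ 0# → x ≡ 0# ⊎ y ≡ 0#
  *≡0⇒ {x} {y} xy≡0 with x ≟ 0#
  ... | yes x≡0 = inj₁ x≡0
  ... | no  x≢0 = inj₂ (*-cancelˡ x≢0 (trans xy≡0 (sym (zeroʳ x))))

  difference-of-squares : ∀ x e → (x - e) * (x + e) ≡ x * x - e * e
  difference-of-squares x e = begin
    (x - e) * (x + e)                      ≡⟨ distribˡ (x - e) x e ⟩
    (x - e) * x + (x - e) * e              ≡⟨ cong₂ _+_ ([y-z]x≈yx-zx x x e) ([y-z]x≈yx-zx e x e) ⟩
    (x * x - e * x) + (x * e - e * e)      ≡⟨ +-assoc (x * x) (- (e * x)) (x * e - e * e) ⟩
    x * x + (- (e * x) + (x * e - e * e))  ≡⟨ cong (x * x +_) (sym (+-assoc (- (e * x)) (x * e) (- (e * e)))) ⟩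
    x * x + (- (e * x) + x * e - e * e)    ≡⟨ cong (λ y → x * x + (- y + x * e - e * e)) (*-comm e x) ⟩
    x * x + (- (x * e) + x * e - e * e)    ≡⟨ cong (λ y → x * x + (y - e * e)) (-‿inverseˡ (x * e)) ⟩
    x * x + (0# - e * e)                   ≡⟨ cong (x * x +_) (+-identityˡ (- (e * e))) ⟩
    x * x - e * e                          ∎

  x*x≡1⇒x≡±1 : ∀ {x} → x * x ≡ 1# → x ≡ 1# ⊎ x ≡ - 1#
  x*x≡1⇒x≡±1 {x} xx≡1 with *≡0⇒ factorisation
    where
    factorisation : (x - 1#) * (x + 1#) ≡ 0#
    factorisation = begin
      (x - 1#) * (x + 1#)  ≡⟨ difference-of-squares x 1# ⟩
      x * x - 1# * 1#      ≡⟨ cong₂ _-_ xx≡1 (*-identityˡ 1#) ⟩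
      1# - 1#              ≡⟨ -‿inverseʳ 1# ⟩
      0#                   ∎
  ... | inj₁ x-1≡0 = inj₁ (x∙y⁻¹≈ε⇒x≈y x 1# x-1≡0)
  ... | inj₂ x+1≡0 = inj₂ (inverseˡ-unique x 1# x+1≡0)

  x+ty≡x′+ty′⇒x-x′≡t[y′-y] : ∀ {x y x′ y′} t → x + t * y ≡ x′ + t * y′ → x - x′ ≡ t * (y′ - y)
  x+ty≡x′+ty′⇒x-x′≡t[y′-y] {x} {y} {x′} {y′} t eq = begin
    x - x′                      ≡⟨ cong (_- x′) (sym (//-rightDividesʳ (t * y) x)) ⟩
    x + t * y - t * y - x′      ≡⟨ cong (λ z → z - t * y - x′) eq ⟩
    x′ + t * y′ - t * y - x′    ≡⟨ cong (_- x′) (+-assoc x′ (t * y′) (- (t * y))) ⟩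
    x′ + (t * y′ - t * y) - x′  ≡⟨ xyx⁻¹≈y x′ (t * y′ - t * y) ⟩
    t * y′ - t * y              ≡⟨ sym (x[y-z]≈xy-xz t y′ y) ⟩
    t * (y′ - y)                ∎

  ^-+ : ∀ x a b → x ^ (a ℕ.+ b) ≡ x ^ a * x ^ b
  ^-+ x zero    b = sym (*-identityˡ (x ^ b))
  ^-+ x (suc a) b = trans (cong (x *_) (^-+ x a b)) (sym (*-assoc x (x ^ a) (x ^ b)))

  ^-* : ∀ x a b → x ^ (a ℕ.* b) ≡ (x ^ a) ^ b
  ^-* x a zero    = cong (x ^_) (ℕ.*-zeroʳ a)
  ^-* x a (suc b) = begin
    x ^ (a ℕ.* suc b)      ≡⟨ cong (x ^_) (ℕ.*-suc a b) ⟩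
    x ^ (a ℕ.+ a ℕ.* b)    ≡⟨ ^-+ x a (a ℕ.* b) ⟩
    x ^ a * x ^ (a ℕ.* b)  ≡⟨ cong (x ^ a *_) (^-* x a b) ⟩
    x ^ a * (x ^ a) ^ b    ∎

  1^ : ∀ k → 1# ^ k ≡ 1#
  1^ zero    = refl
  1^ (suc k) = trans (*-identityˡ (1# ^ k)) (1^ k)

  ^-nonzero : ∀ {x} k → x ≢ 0# → x ^ k ≢ 0#
  ^-nonzero zero    _   = 1≢0
  ^-nonzero (suc k) x≢0 = *-nonzero x≢0 (^-nonzero k x≢0)

  ^-reduce-mod : ∀ {x} p .{{_ : NonZero p}} → x ^ p ≡ 1# → ∀ k → x ^ k ≡ x ^ (k % p)
  ^-reduce-mod {x} p xᵖ≡1 k = begin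
    x ^ k                              ≡⟨ cong (x ^_) (m≡m%n+[m/n]*n k p) ⟩
    x ^ (k % p ℕ.+ k / p ℕ.* p)        ≡⟨ ^-+ x (k % p) _ ⟩
    x ^ (k % p) * x ^ (k / p ℕ.* p)    ≡⟨ cong (λ e → x ^ (k % p) * x ^ e) (ℕ.*-comm (k / p) p) ⟩
    x ^ (k % p) * x ^ (p ℕ.* (k / p))  ≡⟨ cong (x ^ (k % p) *_) (^-* x p (k / p)) ⟩
    x ^ (k % p) * (x ^ p) ^ (k / p)    ≡⟨ cong (λ y → x ^ (k % p) * y ^ (k / p)) xᵖ≡1 ⟩
    x ^ (k % p) * 1# ^ (k / p)         ≡⟨ cong (x ^ (k % p) *_) (1^ (k / p)) ⟩
    x ^ (k % p) * 1#                   ≡⟨ *-identityʳ _ ⟩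
    x ^ (k % p)                        ∎

  ⟦_⟧ : Sign → Carrier
  ⟦ Sign.+ ⟧ = 1#
  ⟦ Sign.- ⟧ = - 1#

  ⟦⟧-homo-* : ∀ s t → ⟦ s Sign.* t ⟧ ≡ ⟦ s ⟧ * ⟦ t ⟧
  ⟦⟧-homo-* Sign.+ t      = sym (*-identityˡ ⟦ t ⟧)
  ⟦⟧-homo-* Sign.- Sign.+ = sym (*-identityʳ (- 1#))
  ⟦⟧-homo-* Sign.- Sign.- = sym (trans (-1*x≈-x (- 1#)) (⁻¹-involutive 1#))

  ⟦s⟧*⟦s⟧≡1 : ∀ s → ⟦ s ⟧ * ⟦ s ⟧ ≡ 1#
  ⟦s⟧*⟦s⟧≡1 s = trans (sym (⟦⟧-homo-* s s)) (cong ⟦_⟧ (s*s≡+ s))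

  ⟦⟧-flip : ∀ s {y z} → y ≡ ⟦ s ⟧ * z → z ≡ ⟦ s ⟧ * y
  ⟦⟧-flip s {y} {z} y≡sz = sym $ begin
    ⟦ s ⟧ * y            ≡⟨ cong (⟦ s ⟧ *_) y≡sz ⟩
    ⟦ s ⟧ * (⟦ s ⟧ * z)  ≡⟨ sym (*-assoc ⟦ s ⟧ ⟦ s ⟧ z) ⟩
    ⟦ s ⟧ * ⟦ s ⟧ * z    ≡⟨ cong (_* z) (⟦s⟧*⟦s⟧≡1 s) ⟩
    1# * z               ≡⟨ *-identityˡ z ⟩
    z                    ∎

  ⟦⟧-*-assoc : ∀ s t y → ⟦ s ⟧ * (⟦ t ⟧ * y) ≡ ⟦ s Sign.* t ⟧ * y
  ⟦⟧-*-assoc s t y = trans (sym (*-assoc ⟦ s ⟧ ⟦ t ⟧ y)) (cong (_* y) (sym (⟦⟧-homo-* s t)))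

  signed-difference : ∀ σ ρ t x → ⟦ σ ⟧ * (t * x) - ⟦ ρ ⟧ * t ≡ ⟦ σ ⟧ * t * (x - ⟦ σ Sign.* ρ ⟧)
  signed-difference σ ρ t x = sym $ begin
    ⟦ σ ⟧ * t * (x - ⟦ σρ ⟧)                ≡⟨ *-assoc ⟦ σ ⟧ t _ ⟩
    ⟦ σ ⟧ * (t * (x - ⟦ σρ ⟧))              ≡⟨ cong (⟦ σ ⟧ *_) (x[y-z]≈xy-xz t x _) ⟩
    ⟦ σ ⟧ * (t * x - t * ⟦ σρ ⟧)            ≡⟨ x[y-z]≈xy-xz ⟦ σ ⟧ (t * x) _ ⟩
    ⟦ σ ⟧ * (t * x) - ⟦ σ ⟧ * (t * ⟦ σρ ⟧)  ≡⟨ cong (λ y → ⟦ σ ⟧ * (t * x) - ⟦ σ ⟧ * y) (*-comm t _) ⟩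
    ⟦ σ ⟧ * (t * x) - ⟦ σ ⟧ * (⟦ σρ ⟧ * t)  ≡⟨ cong (λ y → ⟦ σ ⟧ * (t * x) - y) (⟦⟧-*-assoc σ σρ t) ⟩
    ⟦ σ ⟧ * (t * x) - ⟦ σ Sign.* σρ ⟧ * t   ≡⟨ cong (λ s → ⟦ σ ⟧ * (t * x) - ⟦ s ⟧ * t) (s*[s*t]≡t σ ρ) ⟩
    ⟦ σ ⟧ * (t * x) - ⟦ ρ ⟧ * t             ∎
    where
    σρ : Sign
    σρ = σ Sign.* ρ

  -1^-sign : ∀ k → ∃[ σ ] (- 1#) ^ k ≡ ⟦ σ ⟧
  -1^-sign zero    = Sign.+ , refl
  -1^-sign (suc k) with -1^-sign k
  ... | σ , [-1]^k≡σ = Sign.- Sign.* σ , trans (cong (- 1# *_) [-1]^k≡σ) (sym (⟦⟧-homo-* Sign.- σ))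

  ∈⟨⟩⁻ : ∀ {h y} → ⟨ h ⟩ y ≡ true → ∃[ k ] h ^ k ≡ y
  ∈⟨⟩⁻ {h} {y} h∋y with satisfied (any⁻ (λ k → does ((h ^ k) ≟ y)) (upTo q) (Equivalence.from T-≡ h∋y))
  ... | k , hᵏ≡y = k , T-does⇒ ((h ^ k) ≟ y) hᵏ≡y

  ∈⟨⟩⁺ : ∀ {h y} k → k < q → h ^ k ≡ y → ⟨ h ⟩ y ≡ true
  ∈⟨⟩⁺ {h} {y} k k<q hᵏ≡y =
    Equivalence.to T-≡ (any⁺ _ (lose (∈-upTo⁺ k<q) (Equivalence.from T-≡ (dec-true ((h ^ k) ≟ y) hᵏ≡y))))

  ∈·⁻ : ∀ {h S y} → (h · S) y ≡ true → ∃[ s ] S s ≡ true × h * s ≡ y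
  ∈·⁻ {h} {S} {y} hS∋y with satisfied (any⁻ (λ s → S s ∧ does ((h * s) ≟ y)) elements (Equivalence.from T-≡ hS∋y))
  ... | s , Ss∧hs≡y with Equivalence.to T-∧ Ss∧hs≡y
  ...   | S∋s , hs≡y = s , Equivalence.to T-≡ S∋s , T-does⇒ ((h * s) ≟ y) hs≡y

  ∈·⁺ : ∀ {h S y} s → S s ≡ true → h * s ≡ y → (h · S) y ≡ true
  ∈·⁺ {h} {S} {y} s S∋s hs≡y = Equivalence.to T-≡ (any⁺ _ (lose (∈-elements additiveGroup s)
    (Equivalence.from T-∧ (Equivalence.from T-≡ S∋s , Equivalence.from T-≡ (dec-true ((h * s) ≟ y) hs≡y)))))

module PrimitiveElement {q : ℕ} (F : FiniteField q) {θ : FiniteField.Carrier F} (prim : FiniteField.IsPrimitive F θ)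
                        {n : ℕ} {{n-nonZero : NonZero n}} (q≡1+n : q ≡ suc n) where

  open FieldProperties F

  log : ∀ y → y ≢ 0# → ℕ
  log y y≢0 = proj₁ (proj₂ prim y y≢0)

  θ^log : ∀ y (y≢0 : y ≢ 0#) → θ ^ log y y≢0 ≡ y
  θ^log y y≢0 = proj₂ (proj₂ prim y y≢0)

  θ^-nonzero : ∀ k → θ ^ k ≢ 0#
  θ^-nonzero k = ^-nonzero k (proj₁ prim)

  θ^-cancel : ∀ {a b} → a ≤ b → θ ^ a ≡ θ ^ b → θ ^ (b ∸ a) ≡ 1#
  θ^-cancel {a} {b} a≤b θᵃ≡θᵇ = sym (*-cancelˡ (θ^-nonzero a) (begin
    θ ^ a * 1#           ≡⟨ *-identityʳ (θ ^ a) ⟩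
    θ ^ a                ≡⟨ θᵃ≡θᵇ ⟩
    θ ^ b                ≡⟨ cong (θ ^_) (sym (ℕ.m+[n∸m]≡n a≤b)) ⟩
    θ ^ (a ℕ.+ (b ∸ a))  ≡⟨ ^-+ θ a (b ∸ a) ⟩
    θ ^ a * θ ^ (b ∸ a)  ∎))

  to : Fin q → Carrier
  to = Inverse.to (FiniteField.enum F)

  from : Carrier → Fin q
  from = Inverse.from (FiniteField.enum F)

  to-injective : ∀ {k l} → to k ≡ to l → k ≡ l
  to-injective = Injection.injective (↔⇒↣ (FiniteField.enum F))

  from-injective : ∀ {x y} → from x ≡ from y → x ≡ y
  from-injective = Injection.injective (↔⇒↣ (↔-sym (FiniteField.enum F)))

  -- Every nonzero element is a power θ^k with k < p, so encoding the field into Fin (suc p) is injective.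
  period-≥ : ∀ {p} .{{_ : NonZero p}} → θ ^ p ≡ 1# → n ≤ p
  period-≥ {p} θᵖ≡1 = ℕ.≤-pred (subst (_≤ suc p) q≡1+n (injective⇒≤ {f = encode ∘ to} encode-to-injective))
    where
    encode : Carrier → Fin (suc p)
    encode y with y ≟ 0#
    ... | yes _   = Fin.zero
    ... | no y≢0  = Fin.suc (log y y≢0 mod p)

    decode : Fin (suc p) → Carrier
    decode Fin.zero    = 0#
    decode (Fin.suc i) = θ ^ toℕ i

    decode-encode : ∀ y → decode (encode y) ≡ y
    decode-encode y with y ≟ 0#
    ... | yes y≡0 = sym y≡0
    ... | no y≢0  = begin
      θ ^ toℕ (log y y≢0 mod p)  ≡⟨ cong (θ ^_) (toℕ-fromℕ< (m%n<n (log y y≢0) p)) ⟩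
      θ ^ (log y y≢0 % p)        ≡⟨ sym (^-reduce-mod p θᵖ≡1 (log y y≢0)) ⟩
      θ ^ log y y≢0              ≡⟨ θ^log y y≢0 ⟩
      y                          ∎

    encode-to-injective : ∀ {k l} → encode (to k) ≡ encode (to l) → k ≡ l
    encode-to-injective {k} {l} eq = to-injective (begin
      to k                    ≡⟨ sym (decode-encode (to k)) ⟩
      decode (encode (to k))  ≡⟨ cong decode eq ⟩
      decode (encode (to l))  ≡⟨ decode-encode (to l) ⟩
      to l                    ∎)

  index : Carrier → Fin (suc n)
  index = subst Fin q≡1+n ∘ from

  index-injective : ∀ {x y} → index x ≡ index y → x ≡ y
  index-injective = from-injective ∘ subst-injective q≡1+n

  index-0≢index-θ^ : ∀ k → index 0# ≢ index (θ ^ k)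
  index-0≢index-θ^ k eq = θ^-nonzero k (sym (index-injective eq))

  -- The n + 1 powers θ⁰, …, θⁿ are nonzero, and there are only n nonzero elements.
  short-period : ∃[ p ] 0 < p × p ≤ n × θ ^ p ≡ 1#
  short-period with pigeonhole (ℕ.n<1+n n) (punchOut ∘ index-0≢index-θ^ ∘ toℕ)
  ... | i , j , i<j , eq =
    toℕ j ∸ toℕ i , ℕ.m<n⇒0<n∸m i<j , ℕ.≤-trans (ℕ.m∸n≤m (toℕ j) (toℕ i)) (ℕ.≤-pred (toℕ<n j)) ,
    θ^-cancel (ℕ.<⇒≤ i<j)
      (index-injective (punchOut-injective (index-0≢index-θ^ (toℕ i)) (index-0≢index-θ^ (toℕ j)) eq))

  no-short-period : ∀ {d} → 0 < d → d < n → θ ^ d ≢ 1#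
  no-short-period 0<d d<n θᵈ≡1 = ℕ.<⇒≱ d<n (period-≥ {{>-nonZero 0<d}} θᵈ≡1)

  θ^n≡1 : θ ^ n ≡ 1#
  θ^n≡1 with short-period
  ... | p , 0<p , p≤n , θᵖ≡1 =
    subst (λ k → θ ^ k ≡ 1#) (ℕ.≤-antisym p≤n (period-≥ {{>-nonZero 0<p}} θᵖ≡1)) θᵖ≡1

  θ^-injective : ∀ {a b} → a < n → b < n → θ ^ a ≡ θ ^ b → a ≡ b
  θ^-injective {a} {b} a<n b<n θᵃ≡θᵇ with ℕ.<-cmp a b
  ... | tri< a<b _ _ = contradiction (θ^-cancel (ℕ.<⇒≤ a<b) θᵃ≡θᵇ)
                         (no-short-period (ℕ.m<n⇒0<n∸m a<b) (ℕ.≤-<-trans (ℕ.m∸n≤m b a) b<n))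
  ... | tri≈ _ a≡b _ = a≡b
  ... | tri> _ _ b<a = contradiction (θ^-cancel (ℕ.<⇒≤ b<a) (sym θᵃ≡θᵇ))
                         (no-short-period (ℕ.m<n⇒0<n∸m b<a) (ℕ.≤-<-trans (ℕ.m∸n≤m a b) a<n))

  θ^-≡⇒%-≡ : ∀ {a b} → θ ^ a ≡ θ ^ b → a % n ≡ b % n
  θ^-≡⇒%-≡ {a} {b} θᵃ≡θᵇ = θ^-injective (m%n<n a n) (m%n<n b n) (begin
    θ ^ (a % n)  ≡⟨ sym (^-reduce-mod n θ^n≡1 a) ⟩
    θ ^ a        ≡⟨ θᵃ≡θᵇ ⟩
    θ ^ b        ≡⟨ ^-reduce-mod n θ^n≡1 b ⟩
    θ ^ (b % n)  ∎)

module QuadraticResidues {q : ℕ} (F : FiniteField q) {θ : FiniteField.Carrier F} (prim : FiniteField.IsPrimitive F θ)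
                         {n : ℕ} {{n-nonZero : NonZero n}} (q≡1+n : q ≡ suc n) (n-even : parity n ≡ 0ℙ) where

  open FieldProperties F
  open PrimitiveElement F prim q≡1+n

  parity-% : ∀ k → parity (k % n) ≡ parity k
  parity-% k = sym $ begin
    parity k                                          ≡⟨ cong parity (m≡m%n+[m/n]*n k n) ⟩
    parity (k % n ℕ.+ k / n ℕ.* n)                    ≡⟨ ℙ.+-homo-+ (k % n) (k / n ℕ.* n) ⟩
    parity (k % n) ℙ.+ parity (k / n ℕ.* n)           ≡⟨ cong (parity (k % n) ℙ.+_) (ℙ.*-homo-* (k / n) n) ⟩
    parity (k % n) ℙ.+ (parity (k / n) ℙ.* parity n)  ≡⟨ cong (λ π → parity (k % n) ℙ.+ (parity (k / n) ℙ.* π))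
                                                           n-even ⟩
    parity (k % n) ℙ.+ (parity (k / n) ℙ.* 0ℙ)        ≡⟨ cong (parity (k % n) ℙ.+_) (ℙ.*-zeroʳ (parity (k / n))) ⟩
    parity (k % n) ℙ.+ 0ℙ                             ≡⟨ ℙ.+-identityʳ (parity (k % n)) ⟩
    parity (k % n)                                    ∎

  -- The residues are the nonzero squares. The parity of a discrete logarithm is well defined
  -- because the order n of θ is even.
  LogParity : Parity → Carrier → Set
  LogParity π y = ∃[ k ] θ ^ k ≡ y × parity k ≡ π

  Residue NonResidue : Carrier → Set
  Residue    = LogParity 0ℙ
  NonResidue = LogParity 1ℙ

  logParity : ∀ {y} → y ≢ 0# → ∃[ π ] LogParity π y
  logParity {y} y≢0 = parity (log y y≢0) , log y y≢0 , θ^log y y≢0 , refl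

  logParity-unique : ∀ {π π′ y} → LogParity π y → LogParity π′ y → π ≡ π′
  logParity-unique (a , θᵃ≡y , refl) (b , θᵇ≡y , refl) = begin
    parity a        ≡⟨ sym (parity-% a) ⟩
    parity (a % n)  ≡⟨ cong parity (θ^-≡⇒%-≡ (trans θᵃ≡y (sym θᵇ≡y))) ⟩
    parity (b % n)  ≡⟨ parity-% b ⟩
    parity b        ∎

  logParity-nonzero : ∀ {π y} → LogParity π y → y ≢ 0#
  logParity-nonzero (k , θᵏ≡y , _) y≡0 = θ^-nonzero k (trans θᵏ≡y y≡0)

  logParity-* : ∀ {π π′ x y} → LogParity π x → LogParity π′ y → LogParity (π ℙ.+ π′) (x * y)
  logParity-* (a , θᵃ≡x , refl) (b , θᵇ≡y , refl) =
    a ℕ.+ b , trans (^-+ θ a b) (cong₂ _*_ θᵃ≡x θᵇ≡y) , ℙ.+-homo-+ a b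

  θ-nonResidue : NonResidue θ
  θ-nonResidue = 1 , *-identityʳ θ , refl

  residue⇒¬nonResidue : ∀ {y} → Residue y → ¬ NonResidue y
  residue⇒¬nonResidue r n with logParity-unique r n
  ... | ()

  residue-or-nonResidue : ∀ {y} → y ≢ 0# → Residue y ⊎ NonResidue y
  residue-or-nonResidue y≢0 with logParity y≢0
  ... | 0ℙ , r = inj₁ r
  ... | 1ℙ , n = inj₂ n

  nonResidue? : ∀ y → Dec (NonResidue y)
  nonResidue? y with y ≟ 0#
  ... | yes y≡0 = no (λ n → logParity-nonzero n y≡0)
  ... | no  y≢0 with residue-or-nonResidue y≢0
  ...   | inj₁ r = no (residue⇒¬nonResidue r)
  ...   | inj₂ n = yes n

  residue-quotient : ∀ {π x y} → LogParity π x → LogParity π y → ∃[ w ] Residue w × x ≡ w * y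
  residue-quotient {π} {x} {y} x∈π y∈π with inverse y (logParity-nonzero y∈π)
  ... | y⁻¹ , yy⁻¹≡1 = x * y⁻¹ , w-residue , x≡wy
    where
    x≡wy : x ≡ x * y⁻¹ * y
    x≡wy = sym $ begin
      x * y⁻¹ * y    ≡⟨ *-assoc x y⁻¹ y ⟩
      x * (y⁻¹ * y)  ≡⟨ cong (x *_) (trans (*-comm y⁻¹ y) yy⁻¹≡1) ⟩
      x * 1#         ≡⟨ *-identityʳ x ⟩
      x              ∎
    y⁻¹≢0 : y⁻¹ ≢ 0#
    y⁻¹≢0 y⁻¹≡0 = 1≢0 (trans (sym yy⁻¹≡1) (trans (cong (y *_) y⁻¹≡0) (zeroʳ y)))
    w-residue : Residue (x * y⁻¹)
    w-residue with logParity (*-nonzero (logParity-nonzero x∈π) y⁻¹≢0)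
    ... | ρ , w∈ρ = subst (λ ρ′ → LogParity ρ′ _)
      (ℙ.+-cancelʳ-≡ π ρ 0ℙ (logParity-unique (logParity-* w∈ρ y∈π) (subst (LogParity _) x≡wy x∈π)))
      w∈ρ

  -- Equal points K i + θ K j ≡ K i′ + θ K j′ with j ≢ j′ would make K i - K i′ ≡ θ (K j′ - K j)
  -- a nonresidue.
  residue-clique-bound : ∀ {k} (K : Fin k → Carrier) → (∀ {i j} → i ≢ j → Residue (K i - K j)) → k ℕ.* k ≤ q
  residue-clique-bound {k} K difference-residue =
    injective⇒≤ {f = from ∘ point ∘ Inverse.to *↔×}
      (Injection.injective (↔⇒↣ *↔×) ∘ point-injective ∘ from-injective)
    where
    point : Fin k × Fin k → Carrier
    point (i , j) = K i + θ * K j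

    difference-not-nonResidue : ∀ i i′ → ¬ NonResidue (K i - K i′)
    difference-not-nonResidue i i′ with i Fin.≟ i′
    ... | yes refl = λ n → logParity-nonzero n (-‿inverseʳ (K i))
    ... | no i≢i′  = residue⇒¬nonResidue (difference-residue i≢i′)

    point-injective : ∀ {s t} → point s ≡ point t → s ≡ t
    point-injective {i , j} {i′ , j′} eq with j Fin.≟ j′
    ... | no j≢j′ = contradiction
      (subst NonResidue (sym (x+ty≡x′+ty′⇒x-x′≡t[y′-y] θ eq))
        (logParity-* θ-nonResidue (difference-residue (j≢j′ ∘ sym))))
      (difference-not-nonResidue i i′)
    ... | yes refl with i Fin.≟ i′
    ...   | yes refl = refl
    ...   | no i≢i′  = contradiction (begin
      K i - K i′       ≡⟨ x+ty≡x′+ty′⇒x-x′≡t[y′-y] θ eq ⟩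
      θ * (K j - K j)  ≡⟨ cong (θ *_) (-‿inverseʳ (K j)) ⟩
      θ * 0#           ≡⟨ zeroʳ θ ⟩
      0#               ∎) (logParity-nonzero (difference-residue i≢i′))

  module ResidueCosets (u : Sign → Carrier) (u₊u₋-nonResidue : NonResidue (u Sign.+ * u Sign.-)) where

    u-nonzero : ∀ e → u e ≢ 0#
    u-nonzero Sign.+ u₊≡0 =
      logParity-nonzero u₊u₋-nonResidue (trans (cong (_* u Sign.-) u₊≡0) (zeroˡ (u Sign.-)))
    u-nonzero Sign.- u₋≡0 =
      logParity-nonzero u₊u₋-nonResidue (trans (cong (u Sign.+ *_) u₋≡0) (zeroʳ (u Sign.+)))

    u-class : Sign → Parity
    u-class e = proj₁ (logParity (u-nonzero e))

    u∈u-class : ∀ e → LogParity (u-class e) (u e)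
    u∈u-class e = proj₂ (logParity (u-nonzero e))

    u-classes : u-class Sign.+ ℙ.+ u-class Sign.- ≡ 1ℙ
    u-classes = logParity-unique (logParity-* (u∈u-class Sign.+) (u∈u-class Sign.-)) u₊u₋-nonResidue

    residue-coset : ∀ {g} → g ≢ 0# → ∃[ e ] ∃[ w ] Residue w × g ≡ w * u e
    residue-coset g≢0 with logParity g≢0
    ... | π , g∈π with parity-split {u-class Sign.+} {u-class Sign.-} u-classes π
    ...   | inj₁ π≡π₊ = Sign.+ , residue-quotient (subst (λ ρ → LogParity ρ _) π≡π₊ g∈π) (u∈u-class Sign.+)
    ...   | inj₂ π≡π₋ = Sign.- , residue-quotient (subst (λ ρ → LogParity ρ _) π≡π₋ g∈π) (u∈u-class Sign.-)

    cosets-disjoint : ∀ {w w′} → Residue w → Residue w′ → w * u Sign.+ ≢ w′ * u Sign.-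
    cosets-disjoint w-res w′-res eq
      with trans (sym (ℙ.p+p≡0ℙ (u-class Sign.+))) (subst (λ π → u-class Sign.+ ℙ.+ π ≡ 1ℙ) (sym π₊≡π₋) u-classes)
      where
      π₊≡π₋ : u-class Sign.+ ≡ u-class Sign.-
      π₊≡π₋ = logParity-unique (logParity-* w-res (u∈u-class Sign.+))
                (subst (LogParity _) (sym eq) (logParity-* w′-res (u∈u-class Sign.-)))
    ... | ()

    residue-coset-unique : ∀ {w w′} e e′ → Residue w → Residue w′ → w * u e ≡ w′ * u e′ → e ≡ e′
    residue-coset-unique Sign.+ Sign.+ _     _      _  = refl
    residue-coset-unique Sign.- Sign.- _     _      _  = refl
    residue-coset-unique Sign.+ Sign.- w-res w′-res eq = contradiction eq (cosets-disjoint w-res w′-res)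
    residue-coset-unique Sign.- Sign.+ w-res w′-res eq = contradiction (sym eq) (cosets-disjoint w′-res w-res)

module CosetFamily {q : ℕ} (F : FiniteField q) {θ : FiniteField.Carrier F} (prim : FiniteField.IsPrimitive F θ)
                   {m : ℕ} .{{_ : NonZero m}} (q≡4m+1 : q ≡ 4 ℕ.* m ℕ.+ 1) where

  open FieldProperties F

  q≡1+4m : q ≡ suc (4 ℕ.* m)
  q≡1+4m = trans q≡4m+1 (ℕ.+-comm (4 ℕ.* m) 1)

  instance
    4m-nonZero : NonZero (4 ℕ.* m)
    4m-nonZero = ℕ.m*n≢0 4 m

  open PrimitiveElement F prim q≡1+4m
  open QuadraticResidues F prim q≡1+4m (ℙ.*-homo-* 4 m)

  0<m : 0 < m
  0<m = ℕ.>-nonZero⁻¹ m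

  θ^2m≡-1 : θ ^ (2 ℕ.* m) ≡ - 1#
  θ^2m≡-1 = [ (λ θ^2m≡1 → contradiction θ^2m≡1 (no-short-period 0<2m 2m<4m)) , id ]′ (x*x≡1⇒x≡±1 square≡1)
    where
    0<2m : 0 < 2 ℕ.* m
    0<2m = ℕ.*-monoʳ-< 2 0<m
    2m<4m : 2 ℕ.* m < 4 ℕ.* m
    2m<4m = ℕ.*-monoˡ-< m {2} {4} (s≤s (s≤s (s≤s z≤n)))
    square≡1 : θ ^ (2 ℕ.* m) * θ ^ (2 ℕ.* m) ≡ 1#
    square≡1 = begin
      θ ^ (2 ℕ.* m) * θ ^ (2 ℕ.* m)  ≡⟨ sym (^-+ θ (2 ℕ.* m) (2 ℕ.* m)) ⟩
      θ ^ (2 ℕ.* m ℕ.+ 2 ℕ.* m)      ≡⟨ cong (θ ^_) (2*n+2*n≡4*n m) ⟩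
      θ ^ (4 ℕ.* m)                  ≡⟨ θ^n≡1 ⟩
      1#                             ∎

  signExponent : Sign → ℕ
  signExponent Sign.+ = 0
  signExponent Sign.- = 2 ℕ.* m

  ⟦⟧≡θ^signExponent : ∀ σ → ⟦ σ ⟧ ≡ θ ^ signExponent σ
  ⟦⟧≡θ^signExponent Sign.+ = refl
  ⟦⟧≡θ^signExponent Sign.- = sym θ^2m≡-1

  signed-power : ∀ σ a → ⟦ σ ⟧ * θ ^ (2 ℕ.* a) ≡ θ ^ (signExponent σ ℕ.+ 2 ℕ.* a)
  signed-power σ a = trans (cong (_* θ ^ (2 ℕ.* a)) (⟦⟧≡θ^signExponent σ)) (sym (^-+ θ (signExponent σ) (2 ℕ.* a)))

  signed-power-residue : ∀ σ a → Residue (⟦ σ ⟧ * θ ^ (2 ℕ.* a))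
  signed-power-residue σ a = signExponent σ ℕ.+ 2 ℕ.* a , sym (signed-power σ a) ,
    trans (ℙ.+-homo-+ (signExponent σ) (2 ℕ.* a)) (cong₂ ℙ._+_ (parity-signExponent σ) (ℙ.*-homo-* 2 a))
    where
    parity-signExponent : ∀ σ → parity (signExponent σ) ≡ 0ℙ
    parity-signExponent Sign.+ = refl
    parity-signExponent Sign.- = ℙ.*-homo-* 2 m

  signed-power-injective : ∀ {σ τ a b} → a < m → b < m →
                           ⟦ σ ⟧ * θ ^ (2 ℕ.* a) ≡ ⟦ τ ⟧ * θ ^ (2 ℕ.* b) → σ ≡ τ × a ≡ b
  signed-power-injective {σ} {τ} {a} {b} a<m b<m eq =
    exponents-injective σ τ (θ^-injective (exponent<4m σ a<m) (exponent<4m τ b<m)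
      (trans (sym (signed-power σ a)) (trans eq (signed-power τ b))))
    where
    signExponent≤2m : ∀ σ → signExponent σ ≤ 2 ℕ.* m
    signExponent≤2m Sign.+ = z≤n
    signExponent≤2m Sign.- = ℕ.≤-refl
    exponent<4m : ∀ σ {a} → a < m → signExponent σ ℕ.+ 2 ℕ.* a < 4 ℕ.* m
    exponent<4m σ {a} a<m = subst (signExponent σ ℕ.+ 2 ℕ.* a <_) (2*n+2*n≡4*n m)
                                  (ℕ.+-mono-≤-< (signExponent≤2m σ) (ℕ.*-monoʳ-< 2 a<m))
    2a≢2m+2b : ∀ {a b} → a < m → 2 ℕ.* a ≢ 2 ℕ.* m ℕ.+ 2 ℕ.* b
    2a≢2m+2b {a} {b} a<m eq =
      ℕ.<⇒≱ (ℕ.*-monoʳ-< 2 a<m) (subst (2 ℕ.* m ≤_) (sym eq) (ℕ.m≤m+n (2 ℕ.* m) (2 ℕ.* b)))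
    exponents-injective : ∀ σ τ → signExponent σ ℕ.+ 2 ℕ.* a ≡ signExponent τ ℕ.+ 2 ℕ.* b → σ ≡ τ × a ≡ b
    exponents-injective Sign.+ Sign.+ eq = refl , ℕ.*-cancelˡ-≡ a b 2 eq
    exponents-injective Sign.- Sign.- eq = refl , ℕ.*-cancelˡ-≡ a b 2 (ℕ.+-cancelˡ-≡ (2 ℕ.* m) (2 ℕ.* a) (2 ℕ.* b) eq)
    exponents-injective Sign.+ Sign.- eq = contradiction eq (2a≢2m+2b {b = b} a<m)
    exponents-injective Sign.- Sign.+ eq = contradiction (sym eq) (2a≢2m+2b {b = a} b<m)

  even-power-reduction : ∀ k → ∃[ σ ] θ ^ (2 ℕ.* k) ≡ ⟦ σ ⟧ * θ ^ (2 ℕ.* (k % m))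
  even-power-reduction k = let (σ , [-1]^k/m≡σ) = -1^-sign (k / m) in σ , (begin
    θ ^ (2 ℕ.* k)                                    ≡⟨ cong (λ j → θ ^ (2 ℕ.* j)) (m≡m%n+[m/n]*n k m) ⟩
    θ ^ (2 ℕ.* (k % m ℕ.+ k / m ℕ.* m))              ≡⟨ cong (θ ^_) (distribute (k % m) (k / m) m) ⟩
    θ ^ (2 ℕ.* (k % m) ℕ.+ 2 ℕ.* m ℕ.* (k / m))      ≡⟨ ^-+ θ (2 ℕ.* (k % m)) _ ⟩
    θ ^ (2 ℕ.* (k % m)) * θ ^ (2 ℕ.* m ℕ.* (k / m))  ≡⟨ cong (θ ^ (2 ℕ.* (k % m)) *_) (^-* θ (2 ℕ.* m) (k / m)) ⟩
    θ ^ (2 ℕ.* (k % m)) * (θ ^ (2 ℕ.* m)) ^ (k / m)  ≡⟨ cong (λ y → θ ^ (2 ℕ.* (k % m)) * y ^ (k / m)) θ^2m≡-1 ⟩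
    θ ^ (2 ℕ.* (k % m)) * (- 1#) ^ (k / m)           ≡⟨ cong (θ ^ (2 ℕ.* (k % m)) *_) [-1]^k/m≡σ ⟩
    θ ^ (2 ℕ.* (k % m)) * ⟦ σ ⟧                      ≡⟨ *-comm _ ⟦ σ ⟧ ⟩
    ⟦ σ ⟧ * θ ^ (2 ℕ.* (k % m))                      ∎)
    where
    distribute : ∀ a b m → 2 ℕ.* (a ℕ.+ b ℕ.* m) ≡ 2 ℕ.* a ℕ.+ 2 ℕ.* m ℕ.* b
    distribute = solve-∀

  residue⇒signed-power : ∀ {w} → Residue w → ∃[ σ ] ∃[ i ] w ≡ ⟦ σ ⟧ * θ ^ (2 ℕ.* toℕ {m} i)
  residue⇒signed-power {w} (k , θᵏ≡w , k-even) =
    let (j , k≡2j) = parity≡0ℙ⇒≡2* k k-even ; (σ , θ^2j≡) = even-power-reduction j in σ , j mod m , (begin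
      w                                  ≡⟨ sym θᵏ≡w ⟩
      θ ^ k                              ≡⟨ cong (θ ^_) k≡2j ⟩
      θ ^ (2 ℕ.* j)                      ≡⟨ θ^2j≡ ⟩
      ⟦ σ ⟧ * θ ^ (2 ℕ.* (j % m))        ≡⟨ cong (λ i → ⟦ σ ⟧ * θ ^ (2 ℕ.* i)) (sym (toℕ-fromℕ< (m%n<n j m))) ⟩
      ⟦ σ ⟧ * θ ^ (2 ℕ.* toℕ (j mod m))  ∎)

  β : Carrier
  β = θ ^ 2

  A : Fin m → Subset Carrier
  A j = (β ^ toℕ j) · ⟨ β ^ m ⟩

  β^≡θ^2* : ∀ k → β ^ k ≡ θ ^ (2 ℕ.* k)
  β^≡θ^2* k = sym (^-* θ 2 k)

  β^m≡-1 : β ^ m ≡ - 1#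
  β^m≡-1 = trans (β^≡θ^2* m) θ^2m≡-1

  ∈⟨β^m⟩⁻ : ∀ {s} → ⟨ β ^ m ⟩ s ≡ true → ∃[ σ ] s ≡ ⟦ σ ⟧
  ∈⟨β^m⟩⁻ ∋s = let (k , [β^m]^k≡s) = ∈⟨⟩⁻ ∋s ; (σ , [-1]^k≡σ) = -1^-sign k in
    σ , trans (sym [β^m]^k≡s) (trans (cong (_^ k) β^m≡-1) [-1]^k≡σ)

  ∈⟨β^m⟩⁺ : ∀ σ → ⟨ β ^ m ⟩ ⟦ σ ⟧ ≡ true
  ∈⟨β^m⟩⁺ Sign.+ = ∈⟨⟩⁺ 0 (subst (0 <_) (sym q≡1+4m) (s≤s z≤n)) refl
  ∈⟨β^m⟩⁺ Sign.- = ∈⟨⟩⁺ 1 (subst (1 <_) (sym q≡1+4m) (s≤s (ℕ.*-monoʳ-< 4 0<m)))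
                          (trans (*-identityʳ (β ^ m)) β^m≡-1)

  ∈A⁻ : ∀ j {y} → A j y ≡ true → ∃[ σ ] y ≡ ⟦ σ ⟧ * θ ^ (2 ℕ.* toℕ j)
  ∈A⁻ j {y} ∋y = let (s , ∋s , βʲs≡y) = ∈·⁻ ∋y ; (σ , s≡σ) = ∈⟨β^m⟩⁻ ∋s in σ , (begin
    y                          ≡⟨ sym βʲs≡y ⟩
    β ^ toℕ j * s              ≡⟨ cong (β ^ toℕ j *_) s≡σ ⟩
    β ^ toℕ j * ⟦ σ ⟧          ≡⟨ *-comm _ ⟦ σ ⟧ ⟩
    ⟦ σ ⟧ * β ^ toℕ j          ≡⟨ cong (⟦ σ ⟧ *_) (β^≡θ^2* (toℕ j)) ⟩
    ⟦ σ ⟧ * θ ^ (2 ℕ.* toℕ j)  ∎)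

  ∈A⁺ : ∀ j σ → A j (⟦ σ ⟧ * θ ^ (2 ℕ.* toℕ j)) ≡ true
  ∈A⁺ j σ = ∈·⁺ ⟦ σ ⟧ (∈⟨β^m⟩⁺ σ) (trans (*-comm _ ⟦ σ ⟧) (cong (⟦ σ ⟧ *_) (β^≡θ^2* (toℕ j))))

  A-disjoint : ∀ i j → i ≢ j → ∀ y → ¬ (A i y ≡ true × A j y ≡ true)
  A-disjoint i j i≢j y (i∋y , j∋y) = i≢j (same-index (∈A⁻ i i∋y) (∈A⁻ j j∋y))
    where
    same-index : ∃[ σ ] y ≡ ⟦ σ ⟧ * θ ^ (2 ℕ.* toℕ i) → ∃[ τ ] y ≡ ⟦ τ ⟧ * θ ^ (2 ℕ.* toℕ j) → i ≡ j
    same-index (σ , y≡) (τ , y≡′) =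
      toℕ-injective (proj₂ (signed-power-injective {σ} {τ} (toℕ<n i) (toℕ<n j) (trans (sym y≡) y≡′)))

  card-A : ∀ j → card additiveGroup (A j) ≡ 2
  card-A j = card≡2 additiveGroup (∈A⁺ j Sign.+) (∈A⁺ j Sign.-)
    (s≢opposite[s] Sign.+ ∘ proj₁ ∘ signed-power-injective {Sign.+} {Sign.-} (toℕ<n j) (toℕ<n j))
    (λ y → signs ∘ ∈A⁻ j)
    where
    signs : ∀ {y} → ∃[ σ ] y ≡ ⟦ σ ⟧ * θ ^ (2 ℕ.* toℕ j) →
            y ≡ ⟦ Sign.+ ⟧ * θ ^ (2 ℕ.* toℕ j) ⊎ y ≡ ⟦ Sign.- ⟧ * θ ^ (2 ℕ.* toℕ j)
    signs (Sign.+ , y≡) = inj₁ y≡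
    signs (Sign.- , y≡) = inj₂ y≡

  residue-θ^4* : ∀ j → Residue (θ ^ (4 ℕ.* j))
  residue-θ^4* j = 4 ℕ.* j , refl , ℙ.*-homo-* 4 j

  residue-neg : ∀ {y} → Residue y → Residue (- y)
  residue-neg {y} y-res = subst Residue (-1*x≈-x y) (logParity-* (2 ℕ.* m , θ^2m≡-1 , ℙ.*-homo-* 2 m) y-res)

  θ^4*-difference : ∀ {a b} → b ≤ a → θ ^ (4 ℕ.* a) - θ ^ (4 ℕ.* b) ≡ θ ^ (4 ℕ.* b) * (θ ^ (4 ℕ.* (a ∸ b)) - 1#)
  θ^4*-difference {a} {b} b≤a = begin
    θ ^ (4 ℕ.* a) - θ ^ (4 ℕ.* b)                         ≡⟨ cong (λ k → θ ^ k - θ ^ (4 ℕ.* b)) 4a≡4b+4[a-b] ⟩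
    θ ^ (4 ℕ.* b ℕ.+ 4 ℕ.* (a ∸ b)) - θ ^ (4 ℕ.* b)       ≡⟨ cong (_- θ ^ (4 ℕ.* b)) (^-+ θ (4 ℕ.* b) _) ⟩
    θ ^ (4 ℕ.* b) * θ ^ (4 ℕ.* (a ∸ b)) - θ ^ (4 ℕ.* b)   ≡⟨ cong (λ z → θ ^ (4 ℕ.* b) * θ ^ (4 ℕ.* (a ∸ b)) - z)
                                                               (sym (*-identityʳ _)) ⟩
    θ ^ (4 ℕ.* b) * θ ^ (4 ℕ.* (a ∸ b)) - θ ^ (4 ℕ.* b) * 1#  ≡⟨ sym (x[y-z]≈xy-xz _ _ 1#) ⟩
    θ ^ (4 ℕ.* b) * (θ ^ (4 ℕ.* (a ∸ b)) - 1#)            ∎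
    where
    4a≡4b+4[a-b] : 4 ℕ.* a ≡ 4 ℕ.* b ℕ.+ 4 ℕ.* (a ∸ b)
    4a≡4b+4[a-b] = trans (cong (4 ℕ.*_) (sym (ℕ.m+[n∸m]≡n b≤a))) (ℕ.*-distribˡ-+ 4 b (a ∸ b))

  fourthPowerOrZero : Fin (suc m) → Carrier
  fourthPowerOrZero Fin.zero    = 0#
  fourthPowerOrZero (Fin.suc j) = θ ^ (4 ℕ.* toℕ j)

  module _ (all-residue : ∀ c → 1 ≤ c → c < m → Residue (θ ^ (4 ℕ.* c) - 1#)) where

    residue-θ^4*-difference : ∀ {a b} → a < m → b < a → Residue (θ ^ (4 ℕ.* a) - θ ^ (4 ℕ.* b))
    residue-θ^4*-difference {a} {b} a<m b<a = subst Residue (sym (θ^4*-difference (ℕ.<⇒≤ b<a)))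
      (logParity-* (residue-θ^4* b) (all-residue (a ∸ b) (ℕ.m<n⇒0<n∸m b<a) (ℕ.≤-<-trans (ℕ.m∸n≤m a b) a<m)))

    fourthPowerOrZero-differences : ∀ {i j} → i ≢ j → Residue (fourthPowerOrZero i - fourthPowerOrZero j)
    fourthPowerOrZero-differences {Fin.zero}  {Fin.zero}  0≢0 = contradiction refl 0≢0
    fourthPowerOrZero-differences {Fin.zero}  {Fin.suc j} _   =
      subst Residue (sym (+-identityˡ _)) (residue-neg (residue-θ^4* (toℕ j)))
    fourthPowerOrZero-differences {Fin.suc i} {Fin.zero}  _   =
      subst Residue (sym (trans (cong (θ ^ (4 ℕ.* toℕ i) +_) ε⁻¹≈ε) (+-identityʳ _))) (residue-θ^4* (toℕ i))
    fourthPowerOrZero-differences {Fin.suc i} {Fin.suc j} i≢j with ℕ.<-cmp (toℕ i) (toℕ j)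
    ... | tri< i<j _ _ = subst Residue (⁻¹-anti-homo‿- _ _) (residue-neg (residue-θ^4*-difference (toℕ<n j) i<j))
    ... | tri≈ _ i≡j _ = contradiction (cong Fin.suc (toℕ-injective i≡j)) i≢j
    ... | tri> _ _ j<i = residue-θ^4*-difference (toℕ<n i) j<i

  θ^4*-1≢0 : ∀ {c} → 1 ≤ c → c < m → θ ^ (4 ℕ.* c) - 1# ≢ 0#
  θ^4*-1≢0 {c} 1≤c c<m eq =
    no-short-period (ℕ.*-monoʳ-< 4 1≤c) (ℕ.*-monoʳ-< 4 c<m) (x∙y⁻¹≈ε⇒x≈y (θ ^ (4 ℕ.* c)) 1# eq)

  nonResidue-exists : 3 ≤ m → ∃[ c ] 1 ≤ c × c < m × NonResidue (θ ^ (4 ℕ.* c) - 1#)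
  nonResidue-exists 3≤m = search (any? (λ i → (1 ℕ.≤? toℕ i) ×-dec nonResidue? (θ ^ (4 ℕ.* toℕ i) - 1#)))
    where
    4m+1<[1+m]² : 4 ℕ.* m ℕ.+ 1 < suc m ℕ.* suc m
    4m+1<[1+m]² = ℕ.<-≤-trans (subst (4 ℕ.* m ℕ.+ 1 <_) (2+[4m+2]≡4[1+m] m) (ℕ.m≤n+m _ 2))
                              (ℕ.*-monoˡ-≤ (suc m) (s≤s 3≤m))
      where
      2+[4m+2]≡4[1+m] : ∀ m → 2 ℕ.+ suc (4 ℕ.* m ℕ.+ 1) ≡ 4 ℕ.* suc m
      2+[4m+2]≡4[1+m] = solve-∀
    search : Dec (∃[ i ] 1 ≤ toℕ {m} i × NonResidue (θ ^ (4 ℕ.* toℕ i) - 1#)) →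
             ∃[ c ] 1 ≤ c × c < m × NonResidue (θ ^ (4 ℕ.* c) - 1#)
    search (yes (i , 1≤i , nonResidue)) = toℕ i , 1≤i , toℕ<n i , nonResidue
    search (no ∄) = contradiction
      (subst (suc m ℕ.* suc m ≤_) q≡4m+1
        (residue-clique-bound fourthPowerOrZero (fourthPowerOrZero-differences all-residue)))
      (ℕ.<⇒≱ 4m+1<[1+m]²)
      where
      all-residue : ∀ c → 1 ≤ c → c < m → Residue (θ ^ (4 ℕ.* c) - 1#)
      all-residue c 1≤c c<m = [ id , (λ nonResidue → contradiction (fromℕ< c<m ,
          subst (λ k → 1 ≤ k × NonResidue (θ ^ (4 ℕ.* k) - 1#)) (sym (toℕ-fromℕ< c<m)) (1≤c , nonResidue)) ∄) ]′
        (residue-or-nonResidue (θ^4*-1≢0 1≤c c<m))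

  module Shift (c : ℕ) (nonResidue : NonResidue (θ ^ (4 ℕ.* c) - 1#)) where

    x : Carrier
    x = θ ^ (2 ℕ.* c)

    u : Sign → Carrier
    u e = x - ⟦ e ⟧

    u₊u₋≡θ^4c-1 : u Sign.+ * u Sign.- ≡ θ ^ (4 ℕ.* c) - 1#
    u₊u₋≡θ^4c-1 = begin
      (x - 1#) * (x - - 1#)  ≡⟨ cong (λ y → (x - 1#) * (x + y)) (⁻¹-involutive 1#) ⟩
      (x - 1#) * (x + 1#)    ≡⟨ difference-of-squares x 1# ⟩
      x * x - 1# * 1#        ≡⟨ cong₂ _-_ x*x≡θ^4c (*-identityˡ 1#) ⟩
      θ ^ (4 ℕ.* c) - 1#     ∎
      where
      x*x≡θ^4c : x * x ≡ θ ^ (4 ℕ.* c)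
      x*x≡θ^4c = trans (sym (^-+ θ (2 ℕ.* c) (2 ℕ.* c))) (cong (θ ^_) (2*n+2*n≡4*n c))

    open ResidueCosets u (subst NonResidue (sym u₊u₋≡θ^4c-1) nonResidue)

    Decomposition : Carrier → Set
    Decomposition g = ∃[ σ ] ∃[ i ] ∃[ e ] g ≡ ⟦ σ ⟧ * θ ^ (2 ℕ.* toℕ {m} i) * u e

    decomposition : ∀ {g} → g ≢ 0# → Decomposition g
    decomposition g≢0 =
      let (e , w , w-residue , g≡wu) = residue-coset g≢0 ; (σ , i , w≡) = residue⇒signed-power w-residue in
      σ , i , e , trans g≡wu (cong (_* u e) w≡)

    decomposition-unique : ∀ {σ σ′ i i′} e e′ →
      ⟦ σ ⟧ * θ ^ (2 ℕ.* toℕ {m} i) * u e ≡ ⟦ σ′ ⟧ * θ ^ (2 ℕ.* toℕ i′) * u e′ → σ ≡ σ′ × i ≡ i′ × e ≡ e′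
    decomposition-unique {σ} {σ′} {i} {i′} e e′ eq =
      let e≡e′ = residue-coset-unique e e′ (signed-power-residue σ (toℕ i)) (signed-power-residue σ′ (toℕ i′)) eq
          (σ≡σ′ , i≡i′) = signed-power-injective {σ} {σ′} (toℕ<n i) (toℕ<n i′)
                            (*-cancelʳ (u-nonzero e) (subst (λ e″ → _ ≡ ⟦ σ′ ⟧ * _ * u e″) (sym e≡e′) eq))
      in σ≡σ′ , toℕ-injective i≡i′ , e≡e′

    shift-power : ∀ i → ∃[ τ ] θ ^ (2 ℕ.* toℕ (shift i c)) ≡ ⟦ τ ⟧ * (θ ^ (2 ℕ.* toℕ i) * x)
    shift-power i = let (τ , reduction) = even-power-reduction (toℕ i ℕ.+ c) in τ , (begin
      θ ^ (2 ℕ.* toℕ (shift i c))            ≡⟨ cong (λ k → θ ^ (2 ℕ.* k)) (toℕ-shift i c) ⟩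
      θ ^ (2 ℕ.* ((toℕ i ℕ.+ c) % m))        ≡⟨ ⟦⟧-flip τ reduction ⟩
      ⟦ τ ⟧ * θ ^ (2 ℕ.* (toℕ i ℕ.+ c))      ≡⟨ cong (λ k → ⟦ τ ⟧ * θ ^ k) (ℕ.*-distribˡ-+ 2 (toℕ i) c) ⟩
      ⟦ τ ⟧ * θ ^ (2 ℕ.* toℕ i ℕ.+ 2 ℕ.* c)  ≡⟨ cong (⟦ τ ⟧ *_) (^-+ θ (2 ℕ.* toℕ i) (2 ℕ.* c)) ⟩
      ⟦ τ ⟧ * (θ ^ (2 ℕ.* toℕ i) * x)        ∎)

    ∈A-shift⁻ : ∀ i {a} → A (shift i c) a ≡ true → ∃[ σ ] a ≡ ⟦ σ ⟧ * (θ ^ (2 ℕ.* toℕ i) * x)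
    ∈A-shift⁻ i ∋a = let (σ , a≡) = ∈A⁻ (shift i c) ∋a ; (τ , θ^shift≡) = shift-power i in
      σ Sign.* τ , trans a≡ (trans (cong (⟦ σ ⟧ *_) θ^shift≡) (⟦⟧-*-assoc σ τ _))

    ∈A-shift⁺ : ∀ i σ → A (shift i c) (⟦ σ ⟧ * (θ ^ (2 ℕ.* toℕ i) * x)) ≡ true
    ∈A-shift⁺ i σ = let (τ , θ^shift≡) = shift-power i in subst (λ a → A (shift i c) a ≡ true) (begin
      ⟦ σ Sign.* τ ⟧ * θ ^ (2 ℕ.* toℕ (shift i c))   ≡⟨ sym (⟦⟧-*-assoc σ τ _) ⟩
      ⟦ σ ⟧ * (⟦ τ ⟧ * θ ^ (2 ℕ.* toℕ (shift i c)))  ≡⟨ cong (⟦ σ ⟧ *_) (sym (⟦⟧-flip τ θ^shift≡)) ⟩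
      ⟦ σ ⟧ * (θ ^ (2 ℕ.* toℕ i) * x)                ∎) (∈A⁺ (shift i c) (σ Sign.* τ))

    -- An element of A (i + c) is ⟦ σ ⟧ θ^(2i) x and one of A i is ⟦ ρ ⟧ θ^(2i); by signed-difference
    -- their difference is ⟦ σ ⟧ θ^(2i) u (σ ρ), so the solutions of a - b ≡ g correspond to the
    -- decompositions of g.
    module Solutions {g} (σ₀ : Sign) (i₀ : Fin m) (e₀ : Sign) (g≡ : g ≡ ⟦ σ₀ ⟧ * θ ^ (2 ℕ.* toℕ i₀) * u e₀) where

      a₀ b₀ : Carrier
      a₀ = ⟦ σ₀ ⟧ * (θ ^ (2 ℕ.* toℕ i₀) * x)
      b₀ = ⟦ σ₀ Sign.* e₀ ⟧ * θ ^ (2 ℕ.* toℕ i₀)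

      SolvesAt : Fin m → Carrier × Carrier → Set
      SolvesAt i = Solves additiveGroup (A (shift i c)) (A i) g

      solves₀ : SolvesAt i₀ (a₀ , b₀)
      solves₀ = ∈A-shift⁺ i₀ σ₀ , ∈A⁺ i₀ (σ₀ Sign.* e₀) , (begin
        a₀ - b₀                                                     ≡⟨ signed-difference σ₀ (σ₀ Sign.* e₀) _ x ⟩
        ⟦ σ₀ ⟧ * θ ^ (2 ℕ.* toℕ i₀) * u (σ₀ Sign.* (σ₀ Sign.* e₀))  ≡⟨ cong (λ e → ⟦ σ₀ ⟧ * θ ^ (2 ℕ.* toℕ i₀) * u e)
                                                                         (s*[s*t]≡t σ₀ e₀) ⟩
        ⟦ σ₀ ⟧ * θ ^ (2 ℕ.* toℕ i₀) * u e₀                          ≡⟨ sym g≡ ⟩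
        g                                                           ∎)

      solution-unique : ∀ i a b → SolvesAt i (a , b) → i ≡ i₀ × (a , b) ≡ (a₀ , b₀)
      solution-unique i a b (∋a , ∋b , a-b≡g) = from-forms (∈A-shift⁻ i ∋a) (∈A⁻ i ∋b)
        where
        from-forms : ∃[ σ ] a ≡ ⟦ σ ⟧ * (θ ^ (2 ℕ.* toℕ i) * x) → ∃[ ρ ] b ≡ ⟦ ρ ⟧ * θ ^ (2 ℕ.* toℕ i) →
                     i ≡ i₀ × (a , b) ≡ (a₀ , b₀)
        from-forms (σ , a≡) (ρ , b≡) =
          let (σ≡σ₀ , i≡i₀ , σρ≡e₀) = decomposition-unique {σ} {σ₀} {i} {i₀} (σ Sign.* ρ) e₀ (begin
                ⟦ σ ⟧ * θ ^ (2 ℕ.* toℕ i) * u (σ Sign.* ρ)                   ≡⟨ sym (signed-difference σ ρ _ x) ⟩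
                ⟦ σ ⟧ * (θ ^ (2 ℕ.* toℕ i) * x) - ⟦ ρ ⟧ * θ ^ (2 ℕ.* toℕ i)  ≡⟨ cong₂ _-_ (sym a≡) (sym b≡) ⟩
                a - b                                                        ≡⟨ a-b≡g ⟩
                g                                                            ≡⟨ g≡ ⟩
                ⟦ σ₀ ⟧ * θ ^ (2 ℕ.* toℕ i₀) * u e₀                           ∎)
              ρ≡σ₀e₀ = trans (sym (s*[s*t]≡t σ ρ)) (cong₂ Sign._*_ σ≡σ₀ σρ≡e₀)
          in i≡i₀ , cong₂ _,_ (trans a≡ (cong₂ (λ s j → ⟦ s ⟧ * (θ ^ (2 ℕ.* toℕ j) * x)) σ≡σ₀ i≡i₀))
                              (trans b≡ (cong₂ (λ s j → ⟦ s ⟧ * θ ^ (2 ℕ.* toℕ j)) ρ≡σ₀e₀ i≡i₀))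

      total-multiplicity : sum (map (λ i → multΔ additiveGroup (A (shift i c)) (A i) g) (allFin m)) ≡ 1
      total-multiplicity = trans
        (sum-map-single (λ i → multΔ additiveGroup (A (shift i c)) (A i) g) (allFin⁺ m) (∈-allFin i₀)
          (λ {i} _ i≢i₀ → multΔ-none additiveGroup (λ { (a , b) sol → i≢i₀ (proj₁ (solution-unique i a b sol)) })))
        (multΔ-unique additiveGroup (a₀ , b₀) solves₀ (λ { (a , b) sol → proj₂ (solution-unique i₀ a b sol) }))

    isCEDF : 1 ≤ c → c < m → IsCEDF additiveGroup m 2 1 c A
    isCEDF 1≤c c<m = ℕ.≤-refl , ℕ.≤-trans (s≤s 1≤c) c<m , 1≤c , c<m , A-disjoint , card-A , total
      where
      total : ∀ g → g ≢ 0# → sum (map (λ i → multΔ additiveGroup (A (shift i c)) (A i) g) (allFin m)) ≡ 1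
      total g g≢0 = let (σ₀ , i₀ , e₀ , g≡) = decomposition g≢0 in Solutions.total-multiplicity σ₀ i₀ e₀ g≡

open import Data.Nat using (_+_; _*_)

corollary1 : (q m : ℕ) → IsPrimePower q → q ≡ 4 * m + 1 → 13 ≤ q → 2 ≤ m →
    (F : FiniteField q) → (θ : FiniteField.Carrier F) → FiniteField.IsPrimitive F θ →
    Σ ℕ (λ c → 1 ≤ c × c < m ×
      IsCEDF (FiniteField.additiveGroup F) m 2 1 c
        (λ (j : Fin m) → FiniteField._·_ F
           (FiniteField._^_ F (FiniteField._^_ F θ 2) (toℕ j))
           (FiniteField.⟨_⟩ F (FiniteField._^_ F (FiniteField._^_ F θ 2) m))))
corollary1 q m _ q≡4m+1 13≤q _ F θ prim =
  let (c , 1≤c , c<m , nonResidue) = nonResidue-exists 3≤m in c , 1≤c , c<m , Shift.isCEDF c nonResidue 1≤c c<m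
  where
  3≤m : 3 ≤ m
  3≤m = ℕ.*-cancelˡ-≤ 4 (ℕ.≤-pred (subst (13 ≤_) (trans q≡4m+1 (ℕ.+-comm (4 * m) 1)) 13≤q))
  instance
    m-nonZero : NonZero m
    m-nonZero = >-nonZero (ℕ.≤-trans (s≤s z≤n) 3≤m)
  open CosetFamily F prim q≡4m+1
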